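{- The following statement follows from the Parity Conjecture: Let $f(x)\in\mathbf{Z}[x]$ be a separable polynomial of degree 3, and let $p$ be a good prime for $f(x)$. Then for every integer $m$ coprime to $p$ there exist infinitely many elements $d\in\mathcal{S}(f)$ such that $d\equiv m\pmod p$.
   Context: Squarefree integers may be negative and are nonzero. For a nonzero rational number $r$, its squarefree part $S(r)$ is the unique squarefree integer $d$ such that $r/d$ is a square in $\mathbf{Q}$. For a separable nonconstant $f(x)\in\mathbf{Z}[x]$, $\mathcal{S}(f)=\{S(f(r)) : r\in\mathbf{Q},\ f(r)\neq 0\}$. An odd prime $p$ is good for $f(x)$ if the reduced polynomial $\bar f(x)\in\mathbf{F}_p[x]$ has the same degree as $f(x)$ and has nonzero discriminant. For an elliptic curve $E: y^2=g(x)$ over $\mathbf{Q}$ and a squarefree integer $d$, $E_d: dy^2=g(x)$ denotes the quadratic twist of $E$ by $d$. The Parity Conjecture is used in the following form, for quadratic twists: Let $E$ be an elliptic curve over $\mathbf{Q}$ with conductor $N_E$, and let $d$ be a squarefree integer coprime to $2N_E$. Then $(-1)^{\operatorname{rank} E_d(\mathbf{Q})}=(-1)^{\operatorname{rank} E(\mathbf{Q})}\cdot\chi_d(-N_E)$, where $\chi_d$ is the quadratic Dirichlet character associated to the field $\mathbf{Q}(\sqrt d)$. Here, if $D$ is the discriminant of $\mathbf{Q}(\sqrt d)$, $\chi_d$ is given by the Kronecker symbol $\chi_d(n)=\left(\frac{D}{n}\right)$. -}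

module Defs where

open import Data.Bool.Base using (Bool; if_then_else_; not; _∧_; _∨_)
open import Data.Bool.ListAction using (any)
open import Data.Fin.Base using (Fin)
open import Data.Integer.Base as ℤ using (ℤ; +_; -[1+_]; ∣_∣)
import Data.Integer.Divisibility.Signed as ℤ∣
open import Data.List.Base as List using (List; []; _∷_; upTo; filter; filterᵇ; cartesianProductWith)
open import Data.List.Membership.Propositional using (_∉_)
open import Data.Nat.Base as ℕ using (ℕ; zero; suc; _∸_)
import Data.Nat.Divisibility as ℕ∣
import Data.Nat.Properties as ℕ
open import Data.Nat.Coprimality using (Coprime)
open import Data.Nat.ListAction using (product)
open import Data.Nat.Primality using (Prime; prime?)
open import Data.Nat.Primality.Factorisation using (factorise; factors)
open import Data.Product.Base using (Σ; ∃; ∃₂; _×_; _,_)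
open import Data.Rational.Base as ℚ using (ℚ; 0ℚ; 1ℚ; ↥_; ↧_)
import Data.Rational.Properties as ℚ
open import Data.Unit.Base using (⊤)
import Data.Vec.Functional as Vector
open import Relation.Binary.PropositionalEquality using (_≡_; _≢_)
open import Relation.Nullary using (¬_; yes; no)
open import Relation.Nullary.Decidable using (⌊_⌋; _×-dec_)

fromℤ : ℤ → ℚ
fromℤ n = n ℚ./ 1

Infinite : (ℤ → Set) → Set
Infinite P = ∀ (xs : List ℤ) → ∃ λ d → P d × d ∉ xs

_≡_[mod_] : ℤ → ℤ → ℕ → Set
a ≡ b [mod n ] = (+ n) ℤ∣.∣ (a ℤ.- b)

------------------------------------------------------------------------
-- Cubic polynomials

-- c₀ + c₁ x + c₂ x² + c₃ x³
record Cubic (A : Set) : Set where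
  constructor cubic
  field
    c₀ c₁ c₂ c₃ : A

open Cubic public

mapCubic : ∀ {A B : Set} → (A → B) → Cubic A → Cubic B
mapCubic h (cubic a b c d) = cubic (h a) (h b) (h c) (h d)

module _ where
  open import Data.Rational.Base using (_+_; _*_)

  eval : Cubic ℚ → ℚ → ℚ
  eval g x = c₀ g + x * (c₁ g + x * (c₂ g + x * c₃ g))

  evalDeriv : Cubic ℚ → ℚ → ℚ
  evalDeriv g x = c₁ g + x * (fromℤ (+ 2) * c₂ g + x * (fromℤ (+ 3) * c₃ g))

  -- A general element of ℚ[x], lowest coefficient first.
  evalList : List ℚ → ℚ → ℚ
  evalList []       x = 0ℚ
  evalList (a ∷ as) x = a + x * evalList as x

  -- g and g′ generate the unit ideal of ℚ[x].  Since ℚ is infinite, the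
  -- identity u g + v g′ = 1 in ℚ[x] may be tested on rational values.
  Separable : Cubic ℚ → Set
  Separable g = ∃₂ λ (u v : List ℚ) →
    ∀ x → evalList u x * eval g x + evalList v x * evalDeriv g x ≡ 1ℚ

module _ where
  open import Data.Integer.Base using (_+_; _-_; _*_)

  disc : Cubic ℤ → ℤ
  disc (cubic d c b a) =
      b * b * c * c - + 4 * a * c * c * c - + 4 * b * b * b * d
    - + 27 * a * a * d * d + + 18 * a * b * c * d

-- The discriminant is an integral polynomial in the coefficients, so when
-- p ∤ c₃ the discriminant of the reduction mod p is the reduction of disc f.
record Good (f : Cubic ℤ) (p : ℕ) : Set where
  field
    prime      : Prime p
    odd        : p ≢ 2
    sameDegree : ¬ ((+ p) ℤ∣.∣ c₃ f)
    disc≢0     : ¬ ((+ p) ℤ∣.∣ disc f)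

------------------------------------------------------------------------
-- Squarefree parts

Squarefree : ℤ → Set
Squarefree d = d ≢ + 0 × (∀ k → (k ℕ.* k) ℕ∣.∣ ∣ d ∣ → k ≡ 1)

IsSquarefreePart : ℚ → ℤ → Set
IsSquarefreePart r d = Squarefree d × ∃ λ s → r ≡ fromℤ d ℚ.* (s ℚ.* s)

_∈𝒮_ : ℤ → Cubic ℤ → Set
d ∈𝒮 f = ∃ λ r → eval f′ r ≢ 0ℚ × IsSquarefreePart (eval f′ r) d
  where f′ = mapCubic fromℤ f

------------------------------------------------------------------------
-- Elliptic curves y² = g(x) over ℚ, and the ranks of their twists

record EllipticCurve : Set where
  field
    g         : Cubic ℚ
    degree    : c₃ g ≢ 0ℚ
    separable : Separable g

data Point : Set where
  ∞   : Point
  aff : (x y : ℚ) → Point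

-- 1/q, with 1/0 = 0.
recip : ℚ → ℚ
recip q with q ℚ.≟ 0ℚ
... | yes _   = 0ℚ
... | no q≢0 = (ℚ.1/ q) {{ℚ.≢-nonZero q≢0}}

-- The chord-and-tangent law on d y² = g(x).
module GroupLaw (d : ℚ) (g : Cubic ℚ) where
  open import Data.Rational.Base using (_+_; _-_; _*_; -_)

  OnCurve : Point → Set
  OnCurve ∞         = ⊤
  OnCurve (aff x y) = d * (y * y) ≡ eval g x

  neg : Point → Point
  neg ∞         = ∞
  neg (aff x y) = aff x (- y)

  -- The sum of two points, one of which is (x₁ , y₁), whose chord (or
  -- tangent) has slope s and whose other abscissa is x₂.  The abscissae on
  -- this line are the roots of g(x) - d (s (x - x₁) + y₁)².
  onLine : (s x₁ y₁ x₂ : ℚ) → Point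
  onLine s x₁ y₁ x₂ = aff x₃ (- (y₁ + s * (x₃ - x₁)))
    where x₃ = (d * (s * s) - c₂ g) * recip (c₃ g) - x₁ - x₂

  _⊕_ : Point → Point → Point
  ∞ ⊕ Q = Q
  P ⊕ ∞ = P
  aff x₁ y₁ ⊕ aff x₂ y₂ with x₁ ℚ.≟ x₂ | y₁ ℚ.≟ - y₂
  ... | yes _ | yes _ = ∞
  ... | yes _ | no _  = onLine (evalDeriv g x₁ * recip (fromℤ (+ 2) * d * y₁)) x₁ y₁ x₂
  ... | no _  | _     = onLine ((y₂ - y₁) * recip (x₂ - x₁)) x₁ y₁ x₂

  _·ℕ_ : ℕ → Point → Point
  zero  ·ℕ P = ∞
  suc n ·ℕ P = P ⊕ (n ·ℕ P)

  _·_ : ℤ → Point → Point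
  (+ n)    · P = n ·ℕ P
  -[1+ n ] · P = neg (suc n ·ℕ P)

  Independent : ∀ {r} → (Fin r → Point) → Set
  Independent {r} P = ∀ (n : Fin r → ℤ) →
    Vector.foldr _⊕_ ∞ (λ i → n i · P i) ≡ ∞ → ∀ i → n i ≡ + 0

  HasIndependent : ℕ → Set
  HasIndependent r = Σ (Fin r → Point) λ P → (∀ i → OnCurve (P i)) × Independent P

-- rank E_d(ℚ) = r, for E_d : d y² = g(x).  In particular IsRank E (+ 1) is the
-- rank of E itself.
IsRank : EllipticCurve → ℤ → ℕ → Set
IsRank E d r = HasIndependent r × ¬ HasIndependent (suc r)
  where open GroupLaw (fromℤ d) (EllipticCurve.g E)

------------------------------------------------------------------------
-- The conductor, by Tate's algorithm and Ogg's formula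

-- y² + a₁ x y + a₃ y = x³ + a₂ x² + a₄ x + a₆
record Weierstrass : Set where
  constructor weierstrass
  field
    a₁ a₂ a₃ a₄ a₆ : ℤ

open Weierstrass public

module _ where
  open import Data.Integer.Base using (_+_; _-_; _*_; -_)

  b₂ b₄ b₆ b₈ Δ : Weierstrass → ℤ
  b₂ W = a₁ W * a₁ W + + 4 * a₂ W
  b₄ W = + 2 * a₄ W + a₁ W * a₃ W
  b₆ W = a₃ W * a₃ W + + 4 * a₆ W
  b₈ W = a₁ W * a₁ W * a₆ W + + 4 * a₂ W * a₆ W - a₁ W * a₃ W * a₄ W
       + a₂ W * a₃ W * a₃ W - a₄ W * a₄ W
  Δ W = - (b₂ W * b₂ W * b₈ W) - + 8 * b₄ W * b₄ W * b₄ W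
      - + 27 * b₆ W * b₆ W + + 9 * b₂ W * b₄ W * b₆ W

  -- x ↦ x + r, y ↦ y + s x + t
  shift : (r s t : ℤ) → Weierstrass → Weierstrass
  shift r s t (weierstrass a₁ a₂ a₃ a₄ a₆) = weierstrass
    (a₁ + + 2 * s)
    (a₂ - s * a₁ + + 3 * r - s * s)
    (a₃ + r * a₁ + + 2 * t)
    (a₄ - s * a₃ + + 2 * r * a₂ - (t + r * s) * a₁ + + 3 * r * r - + 2 * s * t)
    (a₆ + r * a₄ + r * r * a₂ + r * r * r - t * a₃ - t * t - r * t * a₁)

-- Exact division, used only for k ∣ n.
_quot_ : ℤ → ℤ → ℤ
n quot k with k ℤ∣.∣? n
... | yes (ℤ∣.divides q _) = q
... | no _                 = + 0

-- The exponent of p in n ≢ 0; as v_p(n) ≤ n the bound n on the number of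
-- divisions is never reached before p ∤ n.
valuation : ℕ → ℕ → ℕ
valuation p n = go n n
  where
  go : ℕ → ℕ → ℕ
  go zero    _ = 0
  go (suc k) n with p ℕ∣.∣? n
  ... | yes (ℕ∣.divides q _) = suc (go k q)
  ... | no _                 = 0

module Tate (p : ℕ) where

  -- p^k ∣ n
  infix 7 p^_∣_
  p^_∣_ : ℕ → ℤ → Bool
  p^ k ∣ n = ⌊ (+ (p ℕ.^ k)) ℤ∣.∣? n ⌋

  -- 0, p^k, 2 p^k, …, (p - 1) p^k
  digits : ℕ → List ℤ
  digits k = List.map (λ i → + (i ℕ.* p ℕ.^ k)) (upTo p)

  -- The first model in the list satisfying the condition.  Every use below
  -- is one where such a model exists because the residue field 𝔽_p is
  -- perfect; the default is never taken.
  pick : (Weierstrass → Bool) → Weierstrass → List Weierstrass → Weierstrass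
  pick c W Ws with filterᵇ c Ws
  ... | []    = W
  ... | V ∷ _ = V

  -- Singular point of the reduction moved to the origin.
  toOrigin : Weierstrass → Weierstrass
  toOrigin W = pick (λ V → p^ 1 ∣ a₃ V ∧ p^ 1 ∣ a₄ V ∧ p^ 1 ∣ a₆ V) W
    (cartesianProductWith (λ r t → shift r (+ 0) t W) (digits 0) (digits 0))

  -- p ∣ a₁, a₂;  p² ∣ a₃, a₄;  p³ ∣ a₆.
  toCubic : Weierstrass → Weierstrass
  toCubic W = pick (λ V → p^ 1 ∣ a₁ V ∧ p^ 1 ∣ a₂ V ∧ p^ 2 ∣ a₃ V ∧ p^ 2 ∣ a₄ V ∧ p^ 3 ∣ a₆ V) W
    (cartesianProductWith (λ s t → shift (+ 0) s t W) (digits 0) (digits 1))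

  -- p^i ∣ a₄ and p^j ∣ a₆ after a translation of x by a multiple of p^k.
  moveX : (k i j : ℕ) → Weierstrass → Weierstrass
  moveX k i j W = pick (λ V → p^ i ∣ a₄ V ∧ p^ j ∣ a₆ V) W
    (List.map (λ r → shift r (+ 0) (+ 0) W) (digits k))

  -- p^i ∣ a₃ and p^j ∣ a₆ after a translation of y by a multiple of p^k.
  moveY : (k i j : ℕ) → Weierstrass → Weierstrass
  moveY k i j W = pick (λ V → p^ i ∣ a₃ V ∧ p^ j ∣ a₆ V) W
    (List.map (λ t → shift (+ 0) (+ 0) t W) (digits k))

  -- x ↦ p² x, y ↦ p³ y
  scale : Weierstrass → Weierstrass
  scale (weierstrass a₁ a₂ a₃ a₄ a₆) = weierstrass
    (a₁ quot q 1) (a₂ quot q 2) (a₃ quot q 3) (a₄ quot q 4) (a₆ quot q 6)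
    where
    q : ℕ → ℤ
    q i = + (p ℕ.^ i)

  -- The n of Kodaira type I*ₙ, n ≥ 1, from a model with v(a₂) = 1 and, at
  -- stage k ≥ 1, v(a₃) ≥ k+1, v(a₄) ≥ k+2, v(a₆) ≥ 2k+2.  The tests say
  -- whether Y² + a₃ Y - a₆ and a₂ X² + a₄ X + a₆, divided by the appropriate
  -- powers of p, have distinct roots mod p.  The first argument bounds the
  -- number of stages; n ≤ v(Δ), so the bound v(Δ) is not reached.
  starIndex : ℕ → (k : ℕ) → Weierstrass → ℕ
  starIndex zero    k W = 0
  starIndex (suc m) k W =
    if not (p^ (2 ℕ.* k ℕ.+ 3) ∣ b₆ W) then 2 ℕ.* k ∸ 1 else
    (let V = moveY (k ℕ.+ 1) (k ℕ.+ 2) (2 ℕ.* k ℕ.+ 3) W in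
     if not (p^ (2 ℕ.* k ℕ.+ 5) ∣ (a₄ V ℤ.* a₄ V ℤ.- + 4 ℤ.* a₂ V ℤ.* a₆ V)) then 2 ℕ.* k else
     starIndex m (suc k) (moveX (k ℕ.+ 1) (k ℕ.+ 3) (2 ℕ.* k ℕ.+ 4) V))

  -- f = v(Δ) - m + 1, where m is the number of components of the special
  -- fibre of the minimal model.  The first argument bounds the number of
  -- rescalings; each lowers v(Δ) by 12.
  run : ℕ → Weierstrass → ℕ
  run zero    W  = 0
  run (suc k) W₀ =
    if not (p^ 1 ∣ Δ W₀) then 0 else          -- I₀
    (let W₁ = toOrigin W₀ in
    if not (p^ 1 ∣ b₂ W₁) then 1 else         -- Iₙ
    if not (p^ 2 ∣ a₆ W₁) then v else         -- II
    if not (p^ 3 ∣ b₈ W₁) then v ∸ 1 else     -- III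
    if not (p^ 3 ∣ b₆ W₁) then v ∸ 2 else     -- IV
    (let W₂ = toCubic W₁ in
    -- p⁶ times the discriminant of T³ + (a₂/p) T² + (a₄/p²) T + a₆/p³
    if not (p^ 7 ∣ disc (cubic (a₆ W₂) (a₄ W₂) (a₂ W₂) (+ 1))) then v ∸ 4 else        -- I*₀
    (let W₃ = moveX 1 3 4 W₂ in
    if not (p^ 2 ∣ a₂ W₃) then v ∸ 4 ∸ starIndex v 1 W₃ else                          -- I*ₙ
    if not (p^ 5 ∣ b₆ W₃) then v ∸ 6 else     -- IV*
    (let W₄ = moveY 2 3 5 W₃ in
    if not (p^ 4 ∣ a₄ W₄) then v ∸ 7 else     -- III*
    if not (p^ 6 ∣ a₆ W₄) then v ∸ 8 else     -- II*
    run k (scale W₄)))))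
    where
    v : ℕ
    v = valuation p ∣ Δ W₀ ∣

  exponent : Weierstrass → ℕ
  exponent W = run (suc (valuation p ∣ Δ W ∣)) W

conductorW : Weierstrass → ℕ
conductorW W = product (List.map (λ p → p ℕ.^ Tate.exponent p W)
  (filter (λ p → prime? p ×-dec p ℕ∣.∣? ∣ Δ W ∣) (upTo (suc ∣ Δ W ∣))))

-- With (X , Y) = (D² c₃ x , D³ c₃ y), y² = g(x) becomes
-- Y² = X³ + D² c₂ X² + D⁴ c₁ c₃ X + D⁶ c₀ c₃²; D is chosen to make the
-- coefficients integral, so that they equal their numerators.
integralModel : Cubic ℚ → Weierstrass
integralModel g = weierstrass (+ 0) (↥ (D² * A)) (+ 0) (↥ (D² * D² * B)) (↥ (D² * D² * D² * C))
  where
  open import Data.Rational.Base using (_*_)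
  A = c₂ g
  B = c₁ g * c₃ g
  C = c₀ g * c₃ g * c₃ g
  D = fromℤ (↧ A ℤ.* ↧ B ℤ.* ↧ C)
  D² = D * D

conductor : EllipticCurve → ℕ
conductor E = conductorW (integralModel (EllipticCurve.g E))

------------------------------------------------------------------------
-- The character of ℚ(√d)

legendre : ℤ → ℕ → ℤ
legendre a p =
  if ⌊ (+ p) ℤ∣.∣? a ⌋ then + 0 else
  if any (λ x → ⌊ (+ p) ℤ∣.∣? (+ (x ℕ.* x) ℤ.- a) ⌋) (upTo p) then + 1 else -[1+ 0 ]

kroneckerAt2 : ℤ → ℤ
kroneckerAt2 a =
  if ⌊ (+ 2) ℤ∣.∣? a ⌋ then + 0 else
  if ⌊ (+ 8) ℤ∣.∣? (a ℤ.- + 1) ⌋ ∨ ⌊ (+ 8) ℤ∣.∣? (a ℤ.+ + 1) ⌋ then + 1 else -[1+ 0 ]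

kroneckerAtPrime : ℤ → ℕ → ℤ
kroneckerAtPrime a p = if ⌊ p ℕ.≟ 2 ⌋ then kroneckerAt2 a else legendre a p

kroneckerAt-1 : ℤ → ℤ
kroneckerAt-1 (+ _)    = + 1
kroneckerAt-1 -[1+ _ ] = -[1+ 0 ]

kroneckerℕ : ℤ → ℕ → ℤ
kroneckerℕ a zero      = if ⌊ ∣ a ∣ ℕ.≟ 1 ⌋ then + 1 else + 0
kroneckerℕ a n@(suc _) =
  List.foldr (λ p z → kroneckerAtPrime a p ℤ.* z) (+ 1) (factors (factorise n))

kronecker : ℤ → ℤ → ℤ
kronecker a (+ n)    = kroneckerℕ a n
kronecker a -[1+ n ] = kroneckerAt-1 a ℤ.* kroneckerℕ a (suc n)

-- The discriminant of ℚ(√d), d squarefree (1 when d = 1).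
fieldDisc : ℤ → ℤ
fieldDisc d = if ⌊ (+ 4) ℤ∣.∣? (d ℤ.- + 1) ⌋ then d else + 4 ℤ.* d

χ : ℤ → ℤ → ℤ
χ d n = kronecker (fieldDisc d) n

------------------------------------------------------------------------

-- The twisting formula is meaningful only where χ_d(-N) ≠ 0, i.e. when the
-- discriminant of ℚ(√d) is prime to N; for N even and d ≡ 3 (mod 4) this is
-- not implied by d being prime to 2N, and without it the formula would read
-- ±1 = 0.
ParityConjecture : Set
ParityConjecture =
  ∀ (E : EllipticCurve) (d : ℤ) → Squarefree d →
  let N = conductor E in
  Coprime ∣ d ∣ (2 ℕ.* N) → Coprime ∣ fieldDisc d ∣ N →
  ∀ r r′ → IsRank E (+ 1) r → IsRank E d r′ →
  -[1+ 0 ] ℤ.^ r′ ≡ -[1+ 0 ] ℤ.^ r ℤ.* χ d (ℤ.- (+ N))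

{-# OPTIONS --safe #-}
-- For squarefree n ≡ m (mod p), a point with y ≠ 0 on the twist n y² = f(x)
-- gives n ∈ 𝒮(f).  If n ∉ 𝒮(f), then E : y² = n f(x) has no points but ∞ and
-- those with y = 0, so its rank is 0.  A negative squarefree d ≡ 1 modulo
-- 8 N_E, prime to n, has χ_d(-N_E) = χ_d(-1) = -1, so by parity E_d does not
-- have rank 0, whence d n ∈ 𝒮(f); and d n ≡ m (mod p) if also d ≡ 1 (mod p).
-- Taking E as the base curve makes its rank known without Mordell–Weil.
--
-- Squarefree integers in a residue class a mod M prime to M: up to finitely
-- many exceptions, every prime lies in a class mod M containing infinitely
-- many primes.  Take n ≡ a prime to the exceptions, and replace its prime
-- factors one by one by new, distinct primes of the same classes.
module Submission where

open import Axiom.ExcludedMiddle using (ExcludedMiddle)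
open import Data.Bool.Base using (Bool; true; false)
open import Data.Bool.ListAction using (any)
open import Data.Bool.Properties using (T-≡)
open import Data.Fin.Base using (zero)
open import Data.Integer.Base as ℤ using (ℤ; +_; -[1+_]; ∣_∣)
open import Data.Integer.Coprimality using (Coprime)
open import Data.Integer.DivMod using (_%ℕ_; _/ℕ_; a≡a%ℕn+[a/ℕn]*n; n%ℕd<d)
import Data.Integer.Divisibility.Signed as ℤ∣
import Data.Integer.Properties as ℤ
open import Data.Integer.Solver renaming (module +-*-Solver to ℤ-Solver)
open import Data.List.Base as List using (List; []; _∷_; filter; upTo)
open import Data.List.Membership.Propositional using (_∈_; _∉_; lose)
open import Data.List.Membership.Propositional.Properties using (∈-filter⁺; ∈-filter⁻; ∈-upTo⁺)
open import Data.List.Relation.Unary.All as All using (All; []; _∷_)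
open import Data.List.Relation.Unary.All.Properties using (all-filter; map⁺)
open import Data.List.Relation.Unary.Any using (here; there)
open import Data.List.Relation.Unary.Any.Properties using (any⁺)
open import Data.Nat.Base as ℕ using (ℕ; zero; suc; NonZero; _+_; _*_; _<_; _≤_; _⊔_; pred)
import Data.Nat.Coprimality as ℕ
open import Data.Nat.Divisibility
open import Data.Nat.DivMod using (_%_; m%n<n; m<n⇒m%n≡m; %-distribˡ-+; %-distribˡ-*; %-remove-+ʳ)
open import Data.Nat.ListAction using (product)
open import Data.Nat.ListAction.Properties using (∈⇒∣product; product≢0)
open import Data.Nat.Primality
open import Data.Nat.Primality.Factorisation
open import Data.Nat.Properties
open import Data.Product.Base using (∃; _×_; _,_; proj₁; proj₂)
open import Data.Rational.Base as ℚ using (ℚ; mkℚ; 0ℚ; 1ℚ)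
import Data.Rational.Properties as ℚ
open import Data.Rational.Solver renaming (module +-*-Solver to ℚ-Solver)
open import Data.Sum.Base using (inj₁; inj₂; reduce)
open import Function.Base using (_∘_)
open import Function.Bundles using (Equivalence)
open import Level using (0ℓ)
open import Relation.Binary.PropositionalEquality
open import Relation.Nullary using (¬_; Dec; yes; no; contradiction; ¬?)
open import Relation.Nullary.Decidable using (_×-dec_; ⌊_⌋; isYes≗does; dec-true; dec-false; decidable-stable)
open import Defs

-- Squarefree integers in residue classes

prime-square-coprime : ∀ {q k} → Prime q → ¬ q ∣ k → ℕ.Coprime (k * k) q
prime-square-coprime {q} {k} q-prime q∤k (d∣k² , d∣q) with prime⇒irreducible q-prime d∣q
... | inj₁ d≡1  = d≡1
... | inj₂ refl = contradiction (reduce (euclidsLemma k k q-prime d∣k²)) q∤k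

Squarefreeℕ : ℕ → Set
Squarefreeℕ n = Squarefree (+ n)

squarefree-1 : Squarefreeℕ 1
squarefree-1 = (λ ()) , λ k → m*n≡1⇒m≡1 k k ∘ ∣1⇒≡1

squarefree⇒nonZero : ∀ {n} → Squarefreeℕ n → NonZero n
squarefree⇒nonZero (n≢0 , _) = ℕ.≢-nonZero (n≢0 ∘ cong (λ m → + m))

-- Let k² divide q n. If q divided k, then q² would divide q n and hence q would divide n. Otherwise
-- k² is prime to q, so it divides n.
squarefree-prime-* : ∀ {q n} → Prime q → ¬ q ∣ n → Squarefreeℕ n → Squarefreeℕ (q * n)
squarefree-prime-* {q} {n} q-prime q∤n sf = nz ∘ cong ∣_∣ , squares
  where
  instance
    _ = prime⇒nonZero q-prime
    _ = squarefree⇒nonZero sf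
  nz : q * n ≢ 0
  nz = ℕ.≢-nonZero⁻¹ (q * n) {{m*n≢0 q n}}
  squares : ∀ k → k * k ∣ q * n → k ≡ 1
  squares k k²∣qn with q ∣? k
  ... | yes q∣k = contradiction (*-cancelˡ-∣ q (∣-trans (*-pres-∣ q∣k q∣k) k²∣qn)) q∤n
  ... | no q∤k  = proj₂ sf k (ℕ.coprime-divisor (prime-square-coprime q-prime q∤k) k²∣qn)

squarefree-factorʳ : ∀ b {n} → Squarefreeℕ (b * n) → Squarefreeℕ n
squarefree-factorʳ b {n} sf@(bn≢0 , squares) =
  (λ { refl → bn≢0 (cong (λ m → + m) (*-zeroʳ b)) }) , λ k k²∣n → squares k (∣n⇒∣m*n b k²∣n)

-- a + M t is prime to B! when t is the product of the primes q ≤ B, q ∤ a.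
rough-in-class : ∀ a M B → ℕ.Coprime a M → ∃ λ t → NonZero t ×
  (∀ {q} → Prime q → q ∣ a + M * t → B < q)
rough-in-class a M B a⊥M = product qs , productOfPrimes≢0 qs-prime , rough
  where
  P? = λ q → prime? q ×-dec ¬? (q ∣? a)
  qs = filter P? (upTo (suc B))
  qs-prime : All Prime qs
  qs-prime = All.map proj₁ (all-filter P? (upTo (suc B)))

  rough : ∀ {q} → Prime q → q ∣ a + M * product qs → B < q
  rough {q} q-prime q∣n = ≰⇒> λ q≤B → q≰B q≤B (q ∣? a)
    where
    q≰B : q ≤ B → _ → _
    q≰B q≤B (no q∤a) = q∤a (∣m+n∣m⇒∣n (subst (q ∣_) (+-comm a _) q∣n) (∣n⇒∣m*n M (∈⇒∣product
      (∈-filter⁺ P? (∈-upTo⁺ (ℕ.s≤s q≤B)) (q-prime , q∤a)))))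
    q≰B q≤B (yes q∣a) with euclidsLemma M (product qs) q-prime (∣m+n∣m⇒∣n q∣n q∣a)
    ... | inj₁ q∣M = ¬prime[1] (subst Prime (a⊥M (q∣a , q∣M)) q-prime)
    ... | inj₂ q∣t = proj₂ (proj₂ (∈-filter⁻ P? {xs = upTo (suc B)}
      (factorisationHasAllPrimeFactors q-prime q∣t qs-prime))) q∣a

module _ (M : ℕ) {{_ : NonZero M}} where

  Recurrent : ℕ → Set
  Recurrent c = ∀ B → ∃ λ q → Prime q × B < q × q % M ≡ c

  -- Stands in for Dirichlet's theorem. A class that is not recurrent has no primes beyond some
  -- bound, and the maximum of these finitely many bounds works. Excluded middle tells the two kinds
  -- of classes apart.
  large-primes-recurrent : ExcludedMiddle 0ℓ →
    ∃ λ B → ∀ {q} → Prime q → B < q → Recurrent (q % M)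
  large-primes-recurrent em = let B , h = below M in B , λ q-prime B<q → h q-prime B<q (m%n<n _ M)
    where
    -- Induction over the residues less than `c`; at `c = M` all are covered.
    below : ∀ c → ∃ λ B → ∀ {q} → Prime q → B < q → q % M < c → Recurrent (q % M)
    below zero = 0 , λ _ _ ()
    below (suc c) with below c | em {∃ λ B → ∀ q → Prime q → B < q → q % M ≢ c}
    ... | B , h | yes (B′ , none) = B ⊔ B′ , λ {q} q-prime B⊔B′<q q%M<1+c →
      h q-prime (m⊔n<o⇒m<o B B′ B⊔B′<q)
        (≤∧≢⇒< (ℕ.s≤s⁻¹ q%M<1+c) (none q q-prime (m⊔n<o⇒n<o B B′ B⊔B′<q)))
    ... | B , h | no ¬none = B , λ {q} q-prime B<q q%M<1+c → case q-prime B<q q%M<1+c (q % M ≟ c)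
      where
      recurrent : Recurrent c
      recurrent B′ with em {∃ λ q → Prime q × B′ < q × q % M ≡ c}
      ... | yes found = found
      ... | no ¬found = contradiction (B′ , λ q q-prime B′<q q≡c → ¬found (q , q-prime , B′<q , q≡c)) ¬none
      case : ∀ {q} → Prime q → B < q → q % M < suc c → _ → Recurrent (q % M)
      case q-prime B<q _        (yes q≡c) = subst Recurrent (sym q≡c) recurrent
      case q-prime B<q q%M<1+c (no q≢c)  = h q-prime B<q (≤∧≢⇒< (ℕ.s≤s⁻¹ q%M<1+c) q≢c)

  %-cong-* : ∀ {m m′ n n′} → m % M ≡ m′ % M → n % M ≡ n′ % M → (m * n) % M ≡ (m′ * n′) % M
  %-cong-* {m} {m′} {n} {n′} m≡m′ n≡n′ = begin
    (m * n) % M              ≡⟨ %-distribˡ-* m n M ⟩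
    (m % M * (n % M)) % M    ≡⟨ cong₂ (λ x y → (x * y) % M) m≡m′ n≡n′ ⟩
    (m′ % M * (n′ % M)) % M  ≡⟨ %-distribˡ-* m′ n′ M ⟨
    (m′ * n′) % M            ∎
    where open ≡-Reasoning

  module _ (b : ℕ) where

    -- Asking for `b * n` rather than `n` to be squarefree also keeps `n` prime to `b`, as is needed
    -- when `n` multiplies a number already chosen.
    SquarefreeIn : ℕ → ℕ → Set
    SquarefreeIn B a = ∃ λ n → B < n × Squarefreeℕ (b * n) × n % M ≡ a % M

    -- The new prime `r` is taken beyond `B + b * n`. Exceeding `b * n`, it does not divide it, so
    -- the product stays squarefree; exceeding `B`, it makes `r * n` large whatever the bound on `n`
    -- was.
    squarefree-cons : ∀ {B′ a} q B → Recurrent (q % M) → SquarefreeIn B′ a → SquarefreeIn B (q * a)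
    squarefree-cons q B q-rec (n , _ , sf , n≡a) with q-rec (B + b * n)
    ... | r , r-prime , r-large , r≡q =
      r * n ,
      <-≤-trans (≤-<-trans (m≤m+n B (b * n)) r-large) (m≤m*n r n) ,
      subst Squarefreeℕ swap (squarefree-prime-* r-prime r∤bn sf) ,
      %-cong-* {r} {q} r≡q n≡a
      where
      instance
        _ = squarefree⇒nonZero sf
        _ = squarefree⇒nonZero (squarefree-factorʳ b sf)
      r∤bn : ¬ r ∣ b * n
      r∤bn r∣bn = <⇒≱ r-large (≤-trans (∣⇒≤ r∣bn) (m≤n+m (b * n) B))
      swap : r * (b * n) ≡ b * (r * n)
      swap = trans (sym (*-assoc r b n)) (trans (cong (_* n) (*-comm r b)) (*-assoc b r n))

    -- The bound is only 0 because the empty product is represented by 1.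
    squarefree-product : Squarefreeℕ b → ∀ qs → All (λ q → Recurrent (q % M)) qs →
      SquarefreeIn 0 (product qs)
    squarefree-product sf [] [] =
      1 , ℕ.s≤s ℕ.z≤n , subst Squarefreeℕ (sym (*-identityʳ b)) sf , refl
    squarefree-product sf (q ∷ qs) (q-rec ∷ qs-rec) =
      squarefree-cons q 0 q-rec (squarefree-product sf qs qs-rec)

    squarefree-in-class : ExcludedMiddle 0ℓ → Squarefreeℕ b →
      ∀ a {{_ : NonZero a}} → ℕ.Coprime a M → ∀ B → SquarefreeIn B a
    squarefree-in-class em sf a a⊥M B
      with B₀ , large ← large-primes-recurrent em
      with t , t≢0 , rough ← rough-in-class a M B₀ a⊥M
      = from-factors (factors F) (PrimeFactorisation.isFactorisation F) (All.tabulate recurrent)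
      where
      N = a + M * t
      instance
        _ = t≢0
        _ = m*n≢0 M t
        _ = ℕ.>-nonZero (≤-trans (ℕ.>-nonZero⁻¹ a) (m≤m+n a (M * t)))
      F = factorise N
      -- Both `a` and `M * t` are positive, so `N` has at least one prime factor.
      1<N : 1 < N
      1<N = +-mono-≤ (ℕ.>-nonZero⁻¹ a) (ℕ.>-nonZero⁻¹ (M * t))
      recurrent : ∀ {q} → q ∈ factors F → Recurrent (q % M)
      recurrent q∈F = large q-prime (rough q-prime
          (subst (_ ∣_) (sym (PrimeFactorisation.isFactorisation F)) (∈⇒∣product q∈F)))
        where q-prime = All.lookup (PrimeFactorisation.factorsPrime F) q∈F
      N≡a : N % M ≡ a % M
      N≡a = %-remove-+ʳ a (m∣m*n t)
      from-factors : ∀ qs → N ≡ product qs → All (λ q → Recurrent (q % M)) qs → SquarefreeIn B a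
      from-factors []       N≡1 _ = contradiction N≡1 (>⇒≢ 1<N)
      -- The first prime is replaced last, and this one replacement enforces the bound `B`.
      from-factors (q ∷ qs) N≡∏ (q-rec ∷ qs-rec)
        with n , B<n , sf′ , n≡∏ ← squarefree-cons q B q-rec (squarefree-product sf qs qs-rec)
        = n , B<n , sf′ , trans n≡∏ (trans (cong (_% M) (sym N≡∏)) N≡a)

-- The character χ_d for d ≡ 1 (mod 8N)

conductor-nonZero : ∀ E → NonZero (conductor E)
conductor-nonZero E = product≢0 (map⁺ (All.map (λ {q} (q-prime , _) →
  m^n≢0 q (Tate.exponent q W) {{prime⇒nonZero q-prime}}) (all-filter P? (upTo (suc ∣ Δ W ∣)))))
  where
  W = integralModel (EllipticCurve.g E)
  P? = λ q → prime? q ×-dec q ∣? ∣ Δ W ∣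

⌊⌋-yes : ∀ {P : Set} (P? : Dec P) → P → ⌊ P? ⌋ ≡ true
⌊⌋-yes P? p = trans (isYes≗does P?) (dec-true P? p)

⌊⌋-no : ∀ {P : Set} (P? : Dec P) → ¬ P → ⌊ P? ⌋ ≡ false
⌊⌋-no P? ¬p = trans (isYes≗does P?) (dec-false P? ¬p)

∣-weaken : ∀ {m n i} → m ∣ n → (+ n) ℤ∣.∣ i → (+ m) ℤ∣.∣ i
∣-weaken m∣n = ℤ∣.∣-trans (ℤ∣.∣ᵤ⇒∣ m∣n)

≡1⇒∤ : ∀ {q d} → 1 < q → d ≡ + 1 [mod q ] → ¬ (+ q) ℤ∣.∣ d
≡1⇒∤ {q} {d} 1<q q∣d-1 q∣d = >⇒≢ 1<q (∣1⇒≡1 (ℤ∣.∣⇒∣ᵤ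
  (subst ((+ q) ℤ∣.∣_) (solve 1 (λ d → d :- (d :- con (+ 1)) := con (+ 1)) refl d)
    (ℤ∣.∣m∣n⇒∣m-n q∣d q∣d-1))))
  where open ℤ-Solver

kroneckerAt2≡1 : ∀ d → d ≡ + 1 [mod 8 ] → kroneckerAt2 d ≡ + 1
kroneckerAt2≡1 d d≡1
  rewrite ⌊⌋-no ((+ 2) ℤ∣.∣? d) (≡1⇒∤ {2} {d} (ℕ.s≤s (ℕ.s≤s ℕ.z≤n)) (∣-weaken (divides 4 refl) d≡1))
        | ⌊⌋-yes ((+ 8) ℤ∣.∣? (d ℤ.- + 1)) d≡1
  = refl

-- The root is x = 1, which is among the residues tested because `1 < q`.
1-residue : ∀ d q → 1 < q → d ≡ + 1 [mod q ] →
  any (λ x → ⌊ (+ q) ℤ∣.∣? (+ (x * x) ℤ.- d) ⌋) (upTo q) ≡ true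
1-residue d q 1<q d≡1 = Equivalence.to T-≡ (any⁺ isRoot
    (lose (∈-upTo⁺ 1<q) (Equivalence.from T-≡ (⌊⌋-yes ((+ q) ℤ∣.∣? (+ 1 ℤ.- d)) q∣1-d))))
  where
  open ℤ-Solver
  isRoot : ℕ → Bool
  isRoot x = ⌊ (+ q) ℤ∣.∣? (+ (x * x) ℤ.- d) ⌋
  q∣1-d : (+ q) ℤ∣.∣ (+ 1 ℤ.- d)
  q∣1-d = subst ((+ q) ℤ∣.∣_) (solve 1 (λ d → :- (d :- con (+ 1)) := con (+ 1) :- d) refl d)
    (ℤ∣.∣m⇒∣-m d≡1)

legendre≡1 : ∀ d q → 1 < q → d ≡ + 1 [mod q ] → legendre d q ≡ + 1
legendre≡1 d q 1<q d≡1
  rewrite ⌊⌋-no ((+ q) ℤ∣.∣? d) (≡1⇒∤ {q} {d} 1<q d≡1) | 1-residue d q 1<q d≡1 = refl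

-- The factor 8 serves the prime 2, where the symbol is 1 for d ≡ 1 modulo 8. At odd q, d ≡ 1 modulo
-- q is a nonzero square.
kroneckerAtPrime≡1 : ∀ d q → Prime q → d ≡ + 1 [mod 8 * q ] → kroneckerAtPrime d q ≡ + 1
kroneckerAtPrime≡1 d q q-prime d≡1 with q ≟ 2
... | yes _ = kroneckerAt2≡1 d (∣-weaken (m∣m*n q) d≡1)
... | no _  = legendre≡1 d q (ℕ.nonTrivial⇒n>1 q {{prime⇒nonTrivial q-prime}}) (∣-weaken (n∣m*n 8) d≡1)

kroneckerℕ≡1 : ∀ d n {{_ : NonZero n}} → d ≡ + 1 [mod 8 * n ] → kroneckerℕ d n ≡ + 1
kroneckerℕ≡1 d n@(suc _) d≡1 = go (factors F) (All.tabulate (λ {q} q∈F →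
    kroneckerAtPrime≡1 d q (All.lookup (PrimeFactorisation.factorsPrime F) q∈F)
      (∣-weaken (*-monoʳ-∣ 8 (subst (q ∣_) (sym (PrimeFactorisation.isFactorisation F))
        (∈⇒∣product q∈F))) d≡1)))
  where
  F = factorise n
  go : ∀ qs → All (λ q → kroneckerAtPrime d q ≡ + 1) qs →
    List.foldr (λ q z → kroneckerAtPrime d q ℤ.* z) (+ 1) qs ≡ + 1
  go []       []         = refl
  go (q ∷ qs) (q≡1 ∷ qs≡1) = cong₂ ℤ._*_ q≡1 (go qs qs≡1)

fieldDisc-≡1 : ∀ d → d ≡ + 1 [mod 4 ] → fieldDisc d ≡ d
fieldDisc-≡1 d d≡1 rewrite ⌊⌋-yes ((+ 4) ℤ∣.∣? (d ℤ.- + 1)) d≡1 = refl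

kronecker-negative : ∀ k n → kroneckerℕ -[1+ k ] (suc n) ≡ + 1 → kronecker -[1+ k ] -[1+ n ] ≡ -[1+ 0 ]
kronecker-negative k n eq = cong (-[1+ 0 ] ℤ.*_) eq

-- Being 1 modulo 4, the number is its own field discriminant. Each prime factor of `n` contributes
-- 1, so the sign comes from the symbol at -1 alone.
χ-negative : ∀ k n {{_ : NonZero n}} → -[1+ k ] ≡ + 1 [mod 8 * n ] →
  χ -[1+ k ] (ℤ.- (+ n)) ≡ -[1+ 0 ]
χ-negative k n@(suc m) d≡1 = trans
  (cong (λ D → kronecker D -[1+ m ]) (fieldDisc-≡1 -[1+ k ] (∣-weaken (∣m⇒∣m*n n (divides {4} 2 refl)) d≡1)))
  (kronecker-negative k m (kroneckerℕ≡1 -[1+ k ] n d≡1))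

-- Points on twists

-- The left side is a normalisation that is stuck on a variable `n`; the right side computes.
fromℤ≡mkℚ : ∀ n → fromℤ n ≡ mkℚ n 0 (ℕ.sym (ℕ.1-coprimeTo _))
fromℤ≡mkℚ n = ℚ.↥p/↧p≡p (mkℚ n 0 _)

fromℤ-* : ∀ m n → fromℤ (m ℤ.* n) ≡ fromℤ m ℚ.* fromℤ n
fromℤ-* m n rewrite fromℤ≡mkℚ m | fromℤ≡mkℚ n = refl

fromℤ≢0 : ∀ {n} → n ≢ + 0 → fromℤ n ≢ 0ℚ
fromℤ≢0 {n} n≢0 eq = n≢0 (cong ℚ.↥_ (trans (sym (fromℤ≡mkℚ n)) eq))

reciprocal : ∀ q → q ≢ 0ℚ → ∃ λ r → r ℚ.* q ≡ 1ℚ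
reciprocal q q≢0 = ℚ.1/ q , ℚ.*-inverseˡ q
  where instance _ = ℚ.≢-nonZero q≢0

p*q≡0⇒q≡0 : ∀ p {q} → p ≢ 0ℚ → p ℚ.* q ≡ 0ℚ → q ≡ 0ℚ
p*q≡0⇒q≡0 p {q} p≢0 pq≡0 with r , rp≡1 ← reciprocal p p≢0 = begin
  q                ≡⟨ ℚ.*-identityˡ q ⟨
  1ℚ ℚ.* q         ≡⟨ cong (ℚ._* q) rp≡1 ⟨
  r ℚ.* p ℚ.* q    ≡⟨ ℚ.*-assoc r p q ⟩
  r ℚ.* (p ℚ.* q)  ≡⟨ cong (r ℚ.*_) pq≡0 ⟩
  r ℚ.* 0ℚ         ≡⟨ ℚ.*-zeroʳ r ⟩
  0ℚ               ∎
  where open ≡-Reasoning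

eval-scale : ∀ k g x → eval (mapCubic (k ℚ.*_) g) x ≡ k ℚ.* eval g x
eval-scale k (cubic a b c d) x = solve 6 (λ k a b c d x →
  k :* a :+ x :* (k :* b :+ x :* (k :* c :+ x :* (k :* d))) :=
  k :* (a :+ x :* (b :+ x :* (c :+ x :* d)))) refl k a b c d x
  where open ℚ-Solver

evalDeriv-scale : ∀ k g x → evalDeriv (mapCubic (k ℚ.*_) g) x ≡ k ℚ.* evalDeriv g x
evalDeriv-scale k (cubic a b c d) x = identity (fromℤ (+ 2)) (fromℤ (+ 3))
  where
  open ℚ-Solver
  -- The constants 2 and 3 become variables, as the identity holds for any values in their place.
  identity : ∀ two three → k ℚ.* b ℚ.+ x ℚ.* (two ℚ.* (k ℚ.* c) ℚ.+ x ℚ.* (three ℚ.* (k ℚ.* d))) ≡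
                           k ℚ.* (b ℚ.+ x ℚ.* (two ℚ.* c ℚ.+ x ℚ.* (three ℚ.* d)))
  identity two three = solve 7 (λ k b c d x two three →
    k :* b :+ x :* (two :* (k :* c) :+ x :* (three :* (k :* d))) :=
    k :* (b :+ x :* (two :* c :+ x :* (three :* d)))) refl k b c d x two three

evalList-scale : ∀ k as x → evalList (List.map (k ℚ.*_) as) x ≡ k ℚ.* evalList as x
evalList-scale k []       x = sym (ℚ.*-zeroʳ k)
evalList-scale k (a ∷ as) x rewrite evalList-scale k as x =
  solve 4 (λ k a x e → k :* a :+ x :* (k :* e) := k :* (a :+ x :* e)) refl k a x (evalList as x)
  where open ℚ-Solver

cancel-scale : ∀ r k u v y z → r ℚ.* u ℚ.* (k ℚ.* y) ℚ.+ r ℚ.* v ℚ.* (k ℚ.* z) ≡ r ℚ.* k ℚ.* (u ℚ.* y ℚ.+ v ℚ.* z)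
cancel-scale = solve 6 (λ r k u v y z →
  r :* u :* (k :* y) :+ r :* v :* (k :* z) := r :* k :* (u :* y :+ v :* z)) refl
  where open ℚ-Solver

-- Dividing both Bézout cofactors by `k` compensates for the factor acquired by g and g′.
separable-scale : ∀ {k g} → k ≢ 0ℚ → Separable g → Separable (mapCubic (k ℚ.*_) g)
separable-scale {k} {g} k≢0 (u , v , bézout) with r , rk≡1 ← reciprocal k k≢0 =
  List.map (r ℚ.*_) u , List.map (r ℚ.*_) v , λ x → trans
    (cong₂ ℚ._+_ (cong₂ ℚ._*_ (evalList-scale r u x) (eval-scale k g x))
                 (cong₂ ℚ._*_ (evalList-scale r v x) (evalDeriv-scale k g x)))
    (trans (cancel-scale r k (evalList u x) (evalList v x) (eval g x) (evalDeriv g x))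
           (cong₂ ℚ._*_ rk≡1 (bézout x)))

module _ (d : ℚ) (g : Cubic ℚ) where
  open GroupLaw d g

  ⊕-identityʳ : ∀ P → P ⊕ ∞ ≡ P
  ⊕-identityʳ ∞         = refl
  ⊕-identityʳ (aff _ _) = refl

  P⊕-P : ∀ {x y y′} → y ≡ ℚ.- y′ → aff x y ⊕ aff x y′ ≡ ∞
  P⊕-P {x} {y} {y′} y≡-y′ with x ℚ.≟ x | y ℚ.≟ ℚ.- y′
  ... | yes _   | yes _    = refl
  ... | no x≢x  | _        = contradiction refl x≢x
  ... | yes _   | no y≢-y′ = contradiction y≡-y′ y≢-y′

  -- ∞ and the points with y = 0 are torsion.
  independent⇒y≢0 : HasIndependent 1 → ∃ λ x → ∃ λ y → y ≢ 0ℚ × d ℚ.* (y ℚ.* y) ≡ eval g x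
  independent⇒y≢0 (P , on , ind) = go (P zero) refl (on zero)
    where
    torsion-free : ∀ n → n · P zero ≡ ∞ → n ≡ + 0
    torsion-free n nP≡∞ = ind (λ _ → n) (trans (⊕-identityʳ (n · P zero)) nP≡∞) zero
    go : ∀ Q → P zero ≡ Q → OnCurve Q → _
    go ∞         P≡Q _  = contradiction (torsion-free (+ 1) (trans (⊕-identityʳ (P zero)) P≡Q)) λ ()
    go (aff x y) P≡Q on = x , y , y≢0 , on
      where
      y≢0 : y ≢ 0ℚ
      y≢0 refl = contradiction (torsion-free (+ 2)
        (trans (cong (λ R → (+ 2) · R) P≡Q) (P⊕-P {x} {0ℚ} {0ℚ} refl))) λ ()

-- From d y² = k f(x) follows f(x) = d k (y / k)², and y ≠ 0 gives f(x) ≠ 0.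
independent⇒∈𝒮 : ∀ f k d → Squarefree (d ℤ.* k) →
  GroupLaw.HasIndependent (fromℤ d) (mapCubic (fromℤ k ℚ.*_) (mapCubic fromℤ f)) 1 →
  (d ℤ.* k) ∈𝒮 f
independent⇒∈𝒮 f k d sf ind
  with x , y , y≢0 , on ← independent⇒y≢0 (fromℤ d) _ ind
  with r , rk≡1 ← reciprocal (fromℤ k) (fromℤ≢0 {k} λ { refl → proj₁ sf (ℤ.*-zeroʳ d) })
  = x , fx≢0 , sf , r ℚ.* y , fx≡dks²
  where
  K = fromℤ k
  D = fromℤ d
  fx = eval (mapCubic fromℤ f) x
  on′ : D ℚ.* (y ℚ.* y) ≡ K ℚ.* fx
  on′ = trans on (eval-scale K (mapCubic fromℤ f) x)
  fx≢0 : fx ≢ 0ℚ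
  fx≢0 fx≡0 = y≢0 (p*q≡0⇒q≡0 y y≢0 (p*q≡0⇒q≡0 D (fromℤ≢0 {d} λ { refl → proj₁ sf refl })
    (trans on′ (trans (cong (K ℚ.*_) fx≡0) (ℚ.*-zeroʳ K)))))
  open ≡-Reasoning
  open ℚ-Solver
  fx≡dks² : fx ≡ fromℤ (d ℤ.* k) ℚ.* (r ℚ.* y ℚ.* (r ℚ.* y))
  fx≡dks² = sym (begin
    fromℤ (d ℤ.* k) ℚ.* (r ℚ.* y ℚ.* (r ℚ.* y))
      ≡⟨ cong (ℚ._* (r ℚ.* y ℚ.* (r ℚ.* y))) (fromℤ-* d k) ⟩
    D ℚ.* K ℚ.* (r ℚ.* y ℚ.* (r ℚ.* y))
      ≡⟨ solve 4 (λ D K r y → D :* K :* (r :* y :* (r :* y)) := r :* K :* (r :* (D :* (y :* y)))) refl D K r y ⟩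
    r ℚ.* K ℚ.* (r ℚ.* (D ℚ.* (y ℚ.* y)))
      ≡⟨ cong₂ (λ a b → a ℚ.* (r ℚ.* b)) rk≡1 on′ ⟩
    1ℚ ℚ.* (r ℚ.* (K ℚ.* fx))
      ≡⟨ solve 3 (λ r K z → con 1ℚ :* (r :* (K :* z)) := r :* K :* z) refl r K fx ⟩
    r ℚ.* K ℚ.* fx  ≡⟨ cong (ℚ._* fx) rk≡1 ⟩
    1ℚ ℚ.* fx       ≡⟨ ℚ.*-identityˡ fx ⟩
    fx              ∎)

-- Congruences and squarefree numbers in ℤ

-- Reduces `Infinite` to finding elements of arbitrarily large absolute value.
bounded : ∀ (xs : List ℤ) → ∃ λ B → ∀ x → B < ∣ x ∣ → x ∉ xs
bounded []       = 0 , λ _ _ ()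
bounded (x ∷ xs) with B , h ← bounded xs = ∣ x ∣ ⊔ B , λ where
  _ B<x (here refl) → <-irrefl refl (m⊔n<o⇒m<o ∣ x ∣ B B<x)
  y B<x (there x∈)  → h y (m⊔n<o⇒n<o ∣ x ∣ B B<x) x∈

[mod]-sym : ∀ {n} a b → a ≡ b [mod n ] → b ≡ a [mod n ]
[mod]-sym {n} a b = subst ((+ n) ℤ∣.∣_)
  (solve 2 (λ a b → :- (a :- b) := b :- a) refl a b) ∘ ℤ∣.∣m⇒∣-m
  where open ℤ-Solver

[mod]-trans : ∀ {n} a b c → a ≡ b [mod n ] → b ≡ c [mod n ] → a ≡ c [mod n ]
[mod]-trans {n} a b c a≡b b≡c = subst ((+ n) ℤ∣.∣_)
  (solve 3 (λ a b c → (a :- b) :+ (b :- c) := a :- c) refl a b c) (ℤ∣.∣m∣n⇒∣m+n a≡b b≡c)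
  where open ℤ-Solver

≡%ℕ[mod] : ∀ i n {{_ : NonZero n}} → i ≡ + (i %ℕ n) [mod n ]
≡%ℕ[mod] i n = ℤ∣.divides (i /ℕ n) (trans
  (cong (λ j → j ℤ.- + (i %ℕ n)) (a≡a%ℕn+[a/ℕn]*n i n))
  (solve 2 (λ r q → r :+ q :- r := q) refl (+ (i %ℕ n)) ((i /ℕ n) ℤ.* + n)))
  where open ℤ-Solver

%-≡⇒[mod] : ∀ k i n {{_ : NonZero n}} → k % n ≡ (i %ℕ n) % n → (+ k) ≡ i [mod n ]
%-≡⇒[mod] k i n eq = [mod]-trans (+ k) (+ (i %ℕ n)) i
  (subst (λ r → (+ k) ≡ + r [mod n ]) (trans eq (m<n⇒m%n≡m (n%ℕd<d i n))) (≡%ℕ[mod] (+ k) n))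
  ([mod]-sym i (+ (i %ℕ n)) (≡%ℕ[mod] i n))

-- The residue `m %ℕ p` is nonzero since m is prime to p, and being less than p it is prime to p as
-- well. No cofactor is prescribed here, so `b` is 1.
squarefree-≡ : ExcludedMiddle 0ℓ → ∀ {p} → Prime p → ∀ m → Coprime m (+ p) → ∀ B →
  ∃ λ n → B < n × Squarefreeℕ n × (+ n) ≡ m [mod p ]
squarefree-≡ em {p} p-prime m m⊥p B =
  let n , B<n , sf , n≡r = squarefree-in-class p 1 em squarefree-1 (m %ℕ p)
        (ℕ.sym (ℕ.prime⇒coprime p-prime (n%ℕd<d m p))) B
  in n , B<n , squarefree-factorʳ 1 sf , %-≡⇒[mod] n m p n≡r
  where
  instance
    p≢0 : NonZero p
    p≢0 = prime⇒nonZero p-prime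
    r≢0 : NonZero (m %ℕ p)
    r≢0 = ℕ.≢-nonZero λ r≡0 → ¬prime[1] (subst Prime (m⊥p (ℤ∣.∣⇒∣ᵤ (p∣m r≡0) , ∣-refl)) p-prime)
      where
      p∣m : m %ℕ p ≡ 0 → (+ p) ℤ∣.∣ m
      p∣m r≡0 = subst ((+ p) ℤ∣.∣_) (ℤ.+-identityʳ m) (subst (λ r → m ≡ + r [mod p ]) r≡0 (≡%ℕ[mod] m p))

squarefree-abs : ∀ d → Squarefreeℕ ∣ d ∣ → Squarefree d
squarefree-abs d (d≢0 , squares) = (λ d≡0 → d≢0 (cong (λ i → + ∣ i ∣) d≡0)) , squares

abs-squarefree : ∀ d → Squarefree d → Squarefreeℕ ∣ d ∣
abs-squarefree d (d≢0 , squares) = (d≢0 ∘ ℤ.∣i∣≡0⇒i≡0 ∘ ℤ.+-injective) , squares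

-- Since -(1 + k) - 1 = -(2 + k), congruences of `-[1+ k ]` to 1 are recorded below as divisibility
-- of `2 + k`.
neg-≡1 : ∀ {M} k → M ∣ 2 + k → -[1+ k ] ≡ + 1 [mod M ]
neg-≡1 {M} k M∣ = ℤ∣.∣ᵤ⇒∣ (subst (M ∣_) (sym (cong (suc ∘ suc) (+-identityʳ k))) M∣)

∣suc⇒≡1 : ∀ {e n} → e ∣ n → e ∣ suc n → e ≡ 1
∣suc⇒≡1 {e} {n} e∣n e∣1+n = ∣1⇒≡1 (∣m+n∣m⇒∣n (subst (e ∣_) (+-comm 1 n) e∣1+n) e∣n)

-- The class of -1 is represented by `pred M`, prime to `M` as its neighbour and nonzero as `1 < M`.
-- This class makes `-[1+ k ]` congruent to 1.
squarefree-≡-1 : ExcludedMiddle 0ℓ → ∀ M {{_ : NonZero M}} → 1 < M → ∀ b → Squarefreeℕ b → ∀ B →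
  ∃ λ k → B < suc k × Squarefreeℕ (b * suc k) × M ∣ 2 + k
squarefree-≡-1 em M 1<M b sf B
  with squarefree-in-class M b em sf (pred M) {{ℕ.>-nonZero (ℕ.s≤s⁻¹ (subst (1 <_) (sym (suc-pred M)) 1<M))}}
         (λ (e∣ , e∣M) → ∣suc⇒≡1 e∣ (subst (_ ∣_) (sym (suc-pred M)) e∣M)) B
... | suc k , B<n , sf′ , n≡ = k , B<n , sf′ , m%n≡0⇒n∣m (2 + k) M (begin
  (2 + k) % M                  ≡⟨ %-distribˡ-+ 1 (suc k) M ⟩
  (1 % M + suc k % M) % M      ≡⟨ cong (λ r → (1 % M + r) % M) n≡ ⟩
  (1 % M + pred M % M) % M     ≡⟨ %-distribˡ-+ 1 (pred M) M ⟨
  suc (pred M) % M             ≡⟨ cong (_% M) (suc-pred M) ⟩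
  M % M                        ≡⟨ n∣m⇒m%n≡0 M M ∣-refl ⟩
  0                            ∎)
  where open ≡-Reasoning

-- One multiplier `-[1+ k ]` is made 1 modulo `M`, for the parity argument, and modulo `p`, to
-- preserve the residue class. Taking `b = n` keeps its product with `n` squarefree.
squarefree-twin : ExcludedMiddle 0ℓ → ∀ n → Squarefreeℕ n →
  ∀ M p {{_ : NonZero M}} {{_ : NonZero p}} → 1 < p → ∀ B →
  ∃ λ k → B < ∣ -[1+ k ] ℤ.* + n ∣ × Squarefree (-[1+ k ] ℤ.* + n) × (M ∣ 2 + k) × (p ∣ 2 + k)
squarefree-twin em n n-sf M p 1<p B =
  let k , B<1+k , nk-sf , Mp∣2+k = squarefree-≡-1 em (M * p) (<-≤-trans 1<p (m≤n*m p M)) n n-sf B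
  in k ,
     subst (B <_) (sym (∣kn∣≡ k)) (<-≤-trans B<1+k (m≤n*m (suc k) n)) ,
     squarefree-abs (-[1+ k ] ℤ.* + n) (subst Squarefreeℕ (sym (∣kn∣≡ k)) nk-sf) ,
     ∣-trans (m∣m*n p) Mp∣2+k ,
     ∣-trans (n∣m*n M) Mp∣2+k
  where
  instance
    n≢0 : NonZero n
    n≢0 = squarefree⇒nonZero n-sf
    Mp≢0 : NonZero (M * p)
    Mp≢0 = m*n≢0 M p
  ∣kn∣≡ : ∀ k → ∣ -[1+ k ] ℤ.* + n ∣ ≡ n * suc k
  ∣kn∣≡ k = trans (ℤ.abs-* -[1+ k ] (+ n)) (*-comm (suc k) n)

*-≡1 : ∀ {p} e d m → e ≡ + 1 [mod p ] → d ≡ m [mod p ] → (e ℤ.* d) ≡ m [mod p ]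
*-≡1 {p} e d m e≡1 d≡m = subst ((+ p) ℤ∣.∣_)
  (solve 3 (λ e d m → (e :- con (+ 1)) :* d :+ (d :- m) := e :* d :- m) refl e d m)
  (ℤ∣.∣m∣n⇒∣m+n (ℤ∣.∣m⇒∣m*n d e≡1) d≡m)
  where open ℤ-Solver

-- Parity of the rank of twists

-- The factor d stands on the right, y² = d g(x), so that the twist can itself be the base curve of
-- the parity conjecture.
twist : (g : Cubic ℤ) → c₃ g ≢ + 0 → Separable (mapCubic fromℤ g) → ∀ d → d ≢ + 0 → EllipticCurve
twist g c₃≢0 sep d d≢0 = record
  { g         = mapCubic (fromℤ d ℚ.*_) (mapCubic fromℤ g)
  ; degree    = λ dc₃≡0 → fromℤ≢0 {c₃ g} c₃≢0 (p*q≡0⇒q≡0 (fromℤ d) (fromℤ≢0 {d} d≢0) dc₃≡0)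
  ; separable = separable-scale (fromℤ≢0 {d} d≢0) sep
  }

rank-0 : ∀ {d g} → GroupLaw.HasIndependent d g 0
rank-0 = (λ ()) , (λ ()) , λ _ _ ()

-- With both ranks 0 the formula would read 1 = χ_d(-N), but this value is -1. The coprimality
-- conditions hold because |d| = 1 + k and the multiple 2 + k of 8 N are consecutive.
parity-violated : ParityConjecture → ∀ E k → Squarefree -[1+ k ] → 8 * conductor E ∣ 2 + k →
  IsRank E (+ 1) 0 → ¬ IsRank E -[1+ k ] 0
parity-violated parity E k sf 8N∣2+k rank₁ rank-d =
  contradiction (trans equal-parity (cong (+ 1 ℤ.*_) (χ-negative k N {{conductor-nonZero E}} d≡1))) λ ()
  where
  N = conductor E
  d≡1 : -[1+ k ] ≡ + 1 [mod 8 * N ]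
  d≡1 = neg-≡1 k 8N∣2+k
  d⊥8N : ℕ.Coprime (suc k) (8 * N)
  d⊥8N (e∣d , e∣8N) = ∣suc⇒≡1 e∣d (∣-trans e∣8N 8N∣2+k)
  d⊥2N : ℕ.Coprime (suc k) (2 * N)
  d⊥2N (e∣d , e∣2N) = d⊥8N (e∣d , ∣-trans e∣2N (*-monoˡ-∣ N (divides {2} {8} 4 refl)))
  D⊥N : ℕ.Coprime ∣ fieldDisc -[1+ k ] ∣ N
  D⊥N = subst (λ D → ℕ.Coprime ∣ D ∣ N)
    (sym (fieldDisc-≡1 -[1+ k ] (neg-≡1 k (∣-trans (∣m⇒∣m*n N (divides {4} {8} 2 refl)) 8N∣2+k))))
    (λ (e∣d , e∣N) → d⊥8N (e∣d , ∣n⇒∣m*n 8 e∣N))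
  equal-parity : + 1 ≡ + 1 ℤ.* χ -[1+ k ] (ℤ.- (+ N))
  equal-parity = parity E -[1+ k ] sf d⊥2N D⊥N 0 0 rank₁ rank-d

-- Opaque, because with-abstraction would otherwise unfold Tate's algorithm.
opaque
  parity-modulus : ParityConjecture → ∀ E → ∃ λ M → NonZero M ×
    (∀ k → Squarefree -[1+ k ] → M ∣ 2 + k → IsRank E (+ 1) 0 → ¬ IsRank E -[1+ k ] 0)
  parity-modulus parity E = 8 * conductor E , m*n≢0 8 (conductor E) {{_}} {{conductor-nonZero E}} ,
    parity-violated parity E

squarefree-factorˡ : ∀ c d → Squarefree (c ℤ.* d) → Squarefree c
squarefree-factorˡ c d sf = squarefree-abs c (squarefree-factorʳ ∣ d ∣
  (subst Squarefreeℕ (trans (ℤ.abs-* c d) (*-comm ∣ c ∣ ∣ d ∣)) (abs-squarefree (c ℤ.* d) sf)))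

module _ (em : ExcludedMiddle 0ℓ) (parity : ParityConjecture)
         (f : Cubic ℤ) (c₃≢0 : c₃ f ≢ + 0) (sep : Separable (mapCubic fromℤ f))
         where

  -- If the product were outside 𝒮(f) like `d`, then neither y² = d f(x) nor its twist by `-[1+ k ]`
  -- would have an independent point, and both ranks would be 0.
  twist-∈𝒮 : ∀ d → Squarefree d → ¬ d ∈𝒮 f → ∃ λ M → NonZero M ×
    (∀ k → Squarefree (-[1+ k ] ℤ.* d) → M ∣ 2 + k → (-[1+ k ] ℤ.* d) ∈𝒮 f)
  twist-∈𝒮 d d-sf d∉𝒮
    with M , M≢0 , violated ← parity-modulus parity (twist f c₃≢0 sep d (proj₁ d-sf))
    = M , M≢0 , λ k kd-sf M∣2+k → decidable-stable em λ kd∉𝒮 →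
      violated k (squarefree-factorˡ -[1+ k ] d kd-sf) M∣2+k
        -- The curve is its own twist by 1, so an independent point on it would put 1 · d = d in
        -- 𝒮(f).
        (rank-0 , λ ind → d∉𝒮 (subst (_∈𝒮 f) (ℤ.*-identityˡ d)
          (independent⇒∈𝒮 f d (+ 1) (subst Squarefree (sym (ℤ.*-identityˡ d)) d-sf) ind)))
        (rank-0 , kd∉𝒮 ∘ independent⇒∈𝒮 f d -[1+ k ] kd-sf)

  d-or-twin-∈𝒮 : ∀ {p} → Prime p → ∀ n m B → B < n → Squarefreeℕ n → (+ n) ≡ m [mod p ] →
    ∃ λ d → B < ∣ d ∣ × d ∈𝒮 f × d ≡ m [mod p ]
  d-or-twin-∈𝒮 {p} p-prime n m B B<n n-sf n≡m with em {(+ n) ∈𝒮 f}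
  ... | yes n∈𝒮 = + n , B<n , n∈𝒮 , n≡m
  ... | no n∉𝒮 =
    -- `M` depends on `n` through the curve y² = n f(x), so the multiplier is chosen after `n`.
    let M , M≢0 , twin-∈𝒮 = twist-∈𝒮 (+ n) n-sf n∉𝒮
        k , B<d , d-sf , M∣2+k , p∣2+k =
          squarefree-twin em n n-sf M p {{M≢0}} {{prime⇒nonZero p-prime}}
            (ℕ.nonTrivial⇒n>1 p {{prime⇒nonTrivial p-prime}}) B
    in -[1+ k ] ℤ.* + n , B<d , twin-∈𝒮 k d-sf M∣2+k , *-≡1 -[1+ k ] (+ n) m (neg-≡1 k p∣2+k) n≡m

  infinitely-many : ∀ p → Prime p → ∀ m → Coprime m (+ p) → Infinite (λ d → d ∈𝒮 f × d ≡ m [mod p ])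
  infinitely-many p p-prime m m⊥p xs =
    let B , avoids = bounded xs
        n , B<n , n-sf , n≡m = squarefree-≡ em p-prime m m⊥p B
        d , B<d , d∈𝒮 , d≡m = d-or-twin-∈𝒮 p-prime n m B B<n n-sf n≡m
    in d , (d∈𝒮 , d≡m) , avoids d B<d

proposition3p8 : ExcludedMiddle 0ℓ →
    ParityConjecture →
    (f : Cubic ℤ) → c₃ f ≢ + 0 → Separable (mapCubic fromℤ f) →
    (p : ℕ) → Good f p →
    (m : ℤ) → Coprime m (+ p) →
    Infinite (λ d → d ∈𝒮 f × d ≡ m [mod p ])
proposition3p8 em parity f c₃≢0 sep p good =
  infinitely-many em parity f c₃≢0 sep p (Good.prime good)
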